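{- Let $v=(0,1,0,0,0,0,0,1)$ and $\eta=(3,1)$, so that $k=10$. Let $H_1,H_2,H_3$ be the tournaments defined as follows, each with its vertices ordered by increasing lower index $j$ of $v^i_j$ and given by its set of backward edges under this ordering: $H_1$: vertices $v^1_2,v^1_3,v^1_4,v^1_7,v^1_8,v^1_9,v^1_{10}$, backward edges $(v^1_9,v^1_7),(v^1_9,v^1_4),(v^1_7,v^1_2),(v^1_{10},v^1_8)$; $H_2$: vertices $v^2_1,v^2_2,v^2_6,v^2_7,v^2_8,v^2_9,v^2_{10}$, backward edges $(v^2_6,v^2_1),(v^2_9,v^2_7),(v^2_9,v^2_2),(v^2_7,v^2_2),(v^2_{10},v^2_8)$; $H_3$: vertices $v^3_3,v^3_4,v^3_5,v^3_7,v^3_8,v^3_9,v^3_{10}$, backward edges $(v^3_5,v^3_3),(v^3_9,v^3_4),(v^3_9,v^3_7),(v^3_7,v^3_4),(v^3_{10},v^3_8)$. Let $\mathcal{F}=\{f_1,f_2,f_3\}$ with $f_i:V(H_i)\to\{1,\dots,10\}$, $f_i(v^i_j)=j$. Then $\mathcal{H}=\{H_1,H_2,H_3\}$ has the $(\mathcal{F},v,\eta)$-strong EH-property.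
   Context: Given an ordering of the vertices of a tournament, an edge $(x,y)$ is backward if $y$ precedes $x$; a tournament on an ordered vertex set is determined by its backward edges (all other edges go from earlier to later vertices). Tournaments are finite; transitive = no directed cycle; $tr(T)$ = maximum size of a transitive subtournament of $T$. $V_1$ is complete to $V_2$ if every vertex of $V_1$ has an edge to every vertex of $V_2$. For disjoint nonempty $X,Y$, $d(X,Y)=e_{X,Y}/(|X||Y|)$, $e_{X,Y}$ = number of edges $(x,y)$ with $x\in X,y\in Y$. $\zeta^v(i)=|\{j\le i:v(j)=1\}|$. For a tournament $T$, $c>0$, $0\le\lambda<1$, a $(v,\eta,c,\lambda)$-m-sequence in $T$ is a sequence $\chi=(S_1,\dots,S_m)$ of pairwise disjoint subsets of $V(T)$ ($m$ the length of $v$) such that: if $v(i)=1$, $S_i$ induces a transitive subtournament partitioned into $S_{i,1},\dots,S_{i,\eta(\zeta^v(i))}$ with $S_{i,a}$ complete to $S_{i,b}$ for $a<b$ and $|S_{i,a}|\ge c\,tr(T)$; if $v(i)=0$, $|S_i|\ge c|T|$; $d(S_i,S_j)\ge1-\lambda$ for $i<j$. Its long representation $l(\chi)=(T_1,\dots,T_k)$ replaces each $S_i$ with $v(i)=1$ by $S_{i,1},\dots,S_{i,\eta(\zeta^v(i))}$ in order; $V(\chi)=\bigcup S_i$. A $c'$-strong pair in $\chi$ is a pair $(A,B)$ of disjoint subsets of $V(\chi)$ with $|A|\ge c'|T|$, either $|B|\ge c'|T|$ or ($B$ transitive and $|B|\ge c'\,tr(T)$), and $d(A,B)=1$ or $d(B,A)=1$.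 A finite family $\mathcal{H}=\{H_1,\dots,H_t\}$ with injective $f_i:V(H_i)\to\{1,\dots,k\}$, $\mathcal{F}=\{f_1,\dots,f_t\}$, has the $(\mathcal{F},v,\eta)$-strong EH-property if for every $c_1>0$ there exist $\lambda_0>0,c_2>0$ such that for every tournament $T$, $0\le\lambda\le\lambda_0$ and $(v,\eta,c_1,\lambda)$-m-sequence $\chi$ in $T$ with $l(\chi)=(T_1,\dots,T_k)$, either there exist $i$ and an injective map $x:V(H_i)\to V(T)$ with $x(h)\in T_{f_i(h)}$ for every $h$ which is an isomorphism of $H_i$ onto the subtournament of $T$ induced on its image, or $\chi$ contains a $c_2$-strong pair. -}

module Defs where

open import Data.Bool using (Bool; true; false; _∧_; _∨_; not; if_then_else_; T)
open import Data.Nat as ℕ using (ℕ; zero; suc)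
open import Data.Fin as Fin using (Fin; toℕ; inject₁; fromℕ)
open import Data.Fin.Subset using (Subset; _∈_; _∩_; ∣_∣; Nonempty; Empty)
open import Data.Vec using (Vec; []; _∷_; lookup)
open import Data.List using (List; []; _∷_)
open import Data.List.Membership.DecPropositional using ()
open import Data.Product using (Σ; ∃; _×_; _,_)
open import Data.Sum using (_⊎_)
open import Data.Integer using (+_)
open import Data.Rational as ℚ using (ℚ; _/_; 0ℚ; 1ℚ)
open import Function.Definitions using (Injective)
open import Relation.Binary.PropositionalEquality using (_≡_; _≢_)
open import Relation.Nullary using (¬_)

record Tournament (n : ℕ) : Set where
  field
    adj    : Fin n → Fin n → Bool
    irrefl : ∀ x → adj x x ≡ false
    tourn  : ∀ x y → x ≢ y → adj x y ≡ not (adj y x)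
open Tournament public

⟦_⟧ : ℕ → ℚ
⟦ k ⟧ = (+ k) / 1

Σᶠ : ∀ {n} → (Fin n → ℕ) → ℕ
Σᶠ {zero}  f = 0
Σᶠ {suc n} f = f Fin.zero ℕ.+ Σᶠ (λ i → f (Fin.suc i))

b2n : Bool → ℕ
b2n true  = 1
b2n false = 0

e : ∀ {n} → Tournament n → Subset n → Subset n → ℕ
e T X Y = Σᶠ (λ x → Σᶠ (λ y → b2n (lookup X x ∧ lookup Y y ∧ adj T x y)))

Disjoint : ∀ {n} → Subset n → Subset n → Set
Disjoint p q = Empty (p ∩ q)

-- d(X,Y) ≥ r  (X, Y nonempty, as d is only defined for nonempty sets)
DensAtLeast : ∀ {n} → Tournament n → ℚ → Subset n → Subset n → Set
DensAtLeast T r X Y =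
  Nonempty X × Nonempty Y × r ℚ.* (⟦ ∣ X ∣ ⟧ ℚ.* ⟦ ∣ Y ∣ ⟧) ℚ.≤ ⟦ e T X Y ⟧

DensOne : ∀ {n} → Tournament n → Subset n → Subset n → Set
DensOne T X Y = Nonempty X × Nonempty Y × e T X Y ≡ ∣ X ∣ ℕ.* ∣ Y ∣

Complete : ∀ {n} → Tournament n → Subset n → Subset n → Set
Complete T X Y = ∀ x y → x ∈ X → y ∈ Y → adj T x y ≡ true

DirCycle : ∀ {n} → Tournament n → Subset n → Set
DirCycle {n} T S =
  Σ ℕ λ m → Σ (Fin (suc m) → Fin n) λ w →
    Injective _≡_ _≡_ w × (∀ i → w i ∈ S) ×
    (∀ (i : Fin m) → adj T (w (inject₁ i)) (w (Fin.suc i)) ≡ true) ×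
    adj T (w (fromℕ m)) (w Fin.zero) ≡ true

Transitive : ∀ {n} → Tournament n → Subset n → Set
Transitive T S = ¬ DirCycle T S

IsTr : ∀ {n} → Tournament n → ℕ → Set
IsTr T t = (Σ _ λ S → Transitive T S × ∣ S ∣ ≡ t) ×
           (∀ S → Transitive T S → ∣ S ∣ ℕ.≤ t)

AtLeastTr : ∀ {n} → Tournament n → ℚ → ℕ → Set
AtLeastTr T c s = ∀ t → IsTr T t → c ℚ.* ⟦ t ⟧ ℚ.≤ ⟦ s ⟧

-- m-sequences.  v : Fin m → Bool (v(i) = 1 iff true), η : ℕ → ℕ is
-- 1-indexed (η 1 is the first entry).

-- ζ^v(i) (with 1-based i = toℕ i + 1)
ζ : ∀ {m} → (Fin m → Bool) → Fin m → ℕ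
ζ v i = Σᶠ (λ j → b2n ((toℕ j ℕ.≤ᵇ toℕ i) ∧ v j))

-- number of blocks S_i contributes to the long representation
blk : ∀ {m} → (Fin m → Bool) → (ℕ → ℕ) → Fin m → ℕ
blk v η i = if v i then η (ζ v i) else 1

offset : ∀ {m} → (Fin m → Bool) → (ℕ → ℕ) → Fin m → ℕ
offset v η i = Σᶠ (λ j → if toℕ j ℕ.<ᵇ toℕ i then blk v η j else 0)

record MSeq {n : ℕ} (T : Tournament n) {m : ℕ} (v : Fin m → Bool)
            (η : ℕ → ℕ) (c λ' : ℚ) : Set where
  field
    S    : Fin m → Subset n
    -- for v(i) = 1 : part i a = S_{i,a+1};  for v(i) = 0 : the single
    -- part is S_i itself
    part : (i : Fin m) → Fin (blk v η i) → Subset n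
    S-disj : ∀ i j → i ≢ j → Disjoint (S i) (S j)
    S-dens : ∀ i j → i Fin.< j → DensAtLeast T (1ℚ ℚ.- λ') (S i) (S j)
    case0  : ∀ i → v i ≡ false →
               (c ℚ.* ⟦ n ⟧ ℚ.≤ ⟦ ∣ S i ∣ ⟧) × (∀ a → part i a ≡ S i)
    case1  : ∀ i → v i ≡ true →
               Transitive T (S i) ×
               (∀ x → x ∈ S i → ∃ λ a → x ∈ part i a) ×
               (∀ a x → x ∈ part i a → x ∈ S i) ×
               (∀ a b → a ≢ b → Disjoint (part i a) (part i b)) ×
               (∀ a b → a Fin.< b → Complete T (part i a) (part i b)) ×
               (∀ a → AtLeastTr T c ∣ part i a ∣)
open MSeq public

module _ {n : ℕ} {T : Tournament n} {m : ℕ} {v : Fin m → Bool}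
         {η : ℕ → ℕ} {c λ' : ℚ} where

  -- x ∈ T_j, where l(χ) = (T_1, …, T_k)  (j is 1-based)
  InLong : MSeq T v η c λ' → ℕ → Fin n → Set
  InLong χ j x = Σ (Fin m) λ i → Σ (Fin (blk v η i)) λ a →
                   (offset v η i ℕ.+ toℕ a ℕ.+ 1 ≡ j) × x ∈ part χ i a

  InV : MSeq T v η c λ' → Fin n → Set
  InV χ x = ∃ λ i → x ∈ S χ i

  StrongPair : MSeq T v η c λ' → ℚ → Set
  StrongPair χ c' = Σ (Subset n) λ A → Σ (Subset n) λ B →
    Disjoint A B × (∀ x → x ∈ A → InV χ x) × (∀ x → x ∈ B → InV χ x) ×
    (c' ℚ.* ⟦ n ⟧ ℚ.≤ ⟦ ∣ A ∣ ⟧) ×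
    ((c' ℚ.* ⟦ n ⟧ ℚ.≤ ⟦ ∣ B ∣ ⟧) ⊎ (Transitive T B × AtLeastTr T c' ∣ B ∣)) ×
    (DensOne T A B ⊎ DensOne T B A)

StrongEH : (t : ℕ) (size : Fin t → ℕ) (H : (i : Fin t) → Tournament (size i))
           (f : (i : Fin t) → Fin (size i) → ℕ)
           {m : ℕ} (v : Fin m → Bool) (η : ℕ → ℕ) → Set
StrongEH t size H f {m} v η =
  ∀ (c₁ : ℚ) → 0ℚ ℚ.< c₁ →
  Σ ℚ λ λ₀ → Σ ℚ λ c₂ → (0ℚ ℚ.< λ₀) × (0ℚ ℚ.< c₂) ×
  (∀ (n : ℕ) (T : Tournament n) (λ' : ℚ) →
     0ℚ ℚ.≤ λ' → λ' ℚ.< 1ℚ → λ' ℚ.≤ λ₀ →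
     (χ : MSeq T v η c₁ λ') →
     (Σ (Fin t) λ i → Σ (Fin (size i) → Fin n) λ x →
        Injective _≡_ _≡_ x ×
        (∀ h → InLong χ (f i h) (x h)) ×
        (∀ a b → adj (H i) a b ≡ adj T (x a) (x b)))
     ⊎ StrongPair χ c₂)

-- Tournaments given by an increasing list of vertex labels and a list
-- of backward edges (pairs of labels).

memPair : ℕ × ℕ → List (ℕ × ℕ) → Bool
memPair p [] = false
memPair (a , b) ((c , d) ∷ xs) = ((a ℕ.≡ᵇ c) ∧ (b ℕ.≡ᵇ d)) ∨ memPair (a , b) xs

backAdj : ∀ {p} → Vec ℕ p → List (ℕ × ℕ) → Fin p → Fin p → Bool
backAdj L B x y =
  memPair (lookup L x , lookup L y) B ∨
  ((toℕ x ℕ.<ᵇ toℕ y) ∧ not (memPair (lookup L y , lookup L x) B))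

module _ where
  open import Data.Fin.Properties using (all?) renaming (_≟_ to _≟ᶠ_)
  open import Data.Bool.Properties using () renaming (_≟_ to _≟ᵇ_)
  open import Relation.Nullary.Decidable using (toWitness; ¬?; _→-dec_; True)

  mkTournament : ∀ {p} (L : Vec ℕ p) (B : List (ℕ × ℕ)) →
    True (all? (λ x → backAdj L B x x ≟ᵇ false)) →
    True (all? (λ x → all? (λ y → ¬? (x ≟ᶠ y) →-dec
                                   (backAdj L B x y ≟ᵇ not (backAdj L B y x))))) →
    Tournament p
  mkTournament L B p q = record
    { adj = backAdj L B
    ; irrefl = toWitness p
    ; tourn = toWitness q }

v₀ : Fin 8 → Bool
v₀ i = lookup (false ∷ true ∷ false ∷ false ∷ false ∷ false ∷ false ∷ true ∷ []) i

η₀ : ℕ → ℕ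
η₀ 1 = 3
η₀ 2 = 1
η₀ _ = 0

L₁ L₂ L₃ : Vec ℕ 7
L₁ = 2 ∷ 3 ∷ 4 ∷ 7 ∷ 8 ∷ 9 ∷ 10 ∷ []
L₂ = 1 ∷ 2 ∷ 6 ∷ 7 ∷ 8 ∷ 9 ∷ 10 ∷ []
L₃ = 3 ∷ 4 ∷ 5 ∷ 7 ∷ 8 ∷ 9 ∷ 10 ∷ []

B₁ B₂ B₃ : List (ℕ × ℕ)
B₁ = (9 , 7) ∷ (9 , 4) ∷ (7 , 2) ∷ (10 , 8) ∷ []
B₂ = (6 , 1) ∷ (9 , 7) ∷ (9 , 2) ∷ (7 , 2) ∷ (10 , 8) ∷ []
B₃ = (5 , 3) ∷ (9 , 4) ∷ (9 , 7) ∷ (7 , 4) ∷ (10 , 8) ∷ []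

Hsize : Fin 3 → ℕ
Hsize _ = 7

Hfam : (i : Fin 3) → Tournament (Hsize i)
Hfam Fin.zero = mkTournament L₁ B₁ _ _
Hfam (Fin.suc Fin.zero) = mkTournament L₂ B₂ _ _
Hfam (Fin.suc (Fin.suc Fin.zero)) = mkTournament L₃ B₃ _ _

Ffam : (i : Fin 3) → Fin (Hsize i) → ℕ
Ffam Fin.zero = lookup L₁
Ffam (Fin.suc Fin.zero) = lookup L₂
Ffam (Fin.suc (Fin.suc Fin.zero)) = lookup L₃

{-# OPTIONS --safe #-}
module Submission where

-- Call a vertex of T_i typical if it has few non-forward edges to every other T_j; for λ small almost
-- all vertices are typical, so after fixing boundedly many typical vertices, half of every T_j is still
-- typical and adjacent in the forward direction to all of them.  Without a strong pair, such halves of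
-- T_i and T_j span a backward edge whenever one of them is linear.
-- All three H_t contain the backward edge 10 → 8; fix it first.  All but a small part of T_9 has an edge
-- to T_4 and all but a small part of T_7 has an edge to T_2, so there is a backward edge x → y from T_9
-- to T_7 together with x → z ∈ T_4 and y → w ∈ T_2.  If y → z, a backward edge from T_5 to T_3 completes
-- H_3; if x → w, a backward edge from T_6 to T_1 completes H_2; otherwise a vertex of T_3 completes H_1.

open import Defs
open import Data.Bool using (Bool; true; false; _∧_; _∨_; not; if_then_else_; T)
open import Data.Bool.Properties using (T?; ¬-not; not-injective) renaming (_≟_ to _≟ᵇ_)
open import Data.Fin as Fin using (Fin; zero; suc; toℕ; #_)
import Data.Fin.Properties as Fin
open import Data.Fin.Subset as Subset using (Subset; ∣_∣; Nonempty)
import Data.Fin.Subset.Properties as Subset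
import Data.Integer as ℤ
import Data.Integer.Properties as ℤ
open import Data.List using (List; []; _∷_; _++_; length; map; filterᵇ; allFin; cartesianProduct)
open import Data.List.Membership.Propositional.Properties using (∈-filter⁺; ∈-cartesianProduct⁺; ∈-allFin)
open import Data.List.Properties using (length-map)
open import Data.List.Relation.Unary.All as All using (All; []; _∷_)
import Data.List.Relation.Unary.All.Properties as All
open import Data.Maybe using (Maybe; just; nothing; is-just; to-witness-T)
open import Data.Nat as ℕ using (ℕ; NonZero; zero; suc; _+_; _*_; _≤_; _<_; _≤ᵇ_; _<ᵇ_; z≤n; s≤s)
import Data.Nat.Properties as ℕ
open import Data.Nat.Tactic.RingSolver using (solve-∀)
open import Data.Product using (Σ; ∃; ∃₂; _×_; _,_; proj₁; proj₂; uncurry)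
open import Data.Rational as ℚ using (ℚ; 0ℚ; 1ℚ; mkℚ)
import Data.Rational.Literals as ℚ
import Data.Rational.Properties as ℚ
open import Data.Rational.Solver using (module +-*-Solver)
import Data.Rational.Unnormalised as ℚᵘ
import Data.Rational.Unnormalised.Properties as ℚᵘ
open import Data.Sum using (_⊎_; inj₁; inj₂)
open import Data.Unit using (⊤)
open import Data.Vec using (Vec; []; _∷_; lookup; tabulate)
import Data.Vec.Properties as Vec
open import Data.Vec.Relation.Binary.Pointwise.Inductive as Pointwise using (Pointwise; []; _∷_)
open import Function using (_∘_; case_of_)
open import Function.Definitions using (Injective)
open import Relation.Binary.Definitions using (tri<; tri≈; tri>)
open import Relation.Binary.PropositionalEquality
open import Relation.Nullary using (¬_; yes; no; does; contradiction)
open import Relation.Nullary.Decidable using (True; toWitness; decidable-stable; _→-dec_)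
open +-*-Solver using (solve; con; _:+_; _:*_; _:-_; _:=_)

-- Finite sums of natural numbers.

Σᶠ-mono : ∀ {n} {f g : Fin n → ℕ} → (∀ i → f i ≤ g i) → Σᶠ f ≤ Σᶠ g
Σᶠ-mono {zero}  f≤g = z≤n
Σᶠ-mono {suc n} f≤g = ℕ.+-mono-≤ (f≤g zero) (Σᶠ-mono (f≤g ∘ suc))

Σᶠ-cong : ∀ {n} {f g : Fin n → ℕ} → (∀ i → f i ≡ g i) → Σᶠ f ≡ Σᶠ g
Σᶠ-cong {zero}  f≡g = refl
Σᶠ-cong {suc n} f≡g = cong₂ _+_ (f≡g zero) (Σᶠ-cong (f≡g ∘ suc))

Σᶠ-0 : ∀ n → Σᶠ {n} (λ _ → 0) ≡ 0
Σᶠ-0 zero    = refl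
Σᶠ-0 (suc n) = Σᶠ-0 n

Σᶠ-+ : ∀ {n} (f g : Fin n → ℕ) → Σᶠ (λ i → f i + g i) ≡ Σᶠ f + Σᶠ g
Σᶠ-+ {zero}  f g = refl
Σᶠ-+ {suc n} f g = begin
  f zero + g zero + Σᶠ (λ i → f (suc i) + g (suc i))        ≡⟨ cong (f zero + g zero +_) (Σᶠ-+ (f ∘ suc) (g ∘ suc)) ⟩
  f zero + g zero + (Σᶠ (f ∘ suc) + Σᶠ (g ∘ suc))           ≡⟨ interchange (f zero) (g zero) (Σᶠ (f ∘ suc)) (Σᶠ (g ∘ suc)) ⟩
  f zero + Σᶠ (f ∘ suc) + (g zero + Σᶠ (g ∘ suc))           ∎
  where
  open ≡-Reasoning
  interchange : ∀ a b c d → a + b + (c + d) ≡ a + c + (b + d)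
  interchange = solve-∀

Σᶠ-*ˡ : ∀ {n} c (f : Fin n → ℕ) → Σᶠ (λ i → c * f i) ≡ c * Σᶠ f
Σᶠ-*ˡ {zero}  c f = sym (ℕ.*-zeroʳ c)
Σᶠ-*ˡ {suc n} c f = trans (cong (c * f zero +_) (Σᶠ-*ˡ c (f ∘ suc))) (sym (ℕ.*-distribˡ-+ c _ _))

Σᶠ-*ʳ : ∀ {n} (f : Fin n → ℕ) c → Σᶠ (λ i → f i * c) ≡ Σᶠ f * c
Σᶠ-*ʳ f c = trans (Σᶠ-cong (λ i → ℕ.*-comm (f i) c)) (trans (Σᶠ-*ˡ c f) (ℕ.*-comm c _))

Σᶠ-swap : ∀ {m n} (f : Fin m → Fin n → ℕ) →
          Σᶠ (λ i → Σᶠ (λ j → f i j)) ≡ Σᶠ (λ j → Σᶠ (λ i → f i j))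
Σᶠ-swap {zero}  {n} f = sym (Σᶠ-0 n)
Σᶠ-swap {suc m} {n} f = trans (cong (Σᶠ (f zero) +_) (Σᶠ-swap (f ∘ suc)))
                              (sym (Σᶠ-+ (f zero) (λ j → Σᶠ (λ i → f (suc i) j))))

-- Counting with Boolean predicates.

private variable
  n : ℕ

Pred : ℕ → Set
Pred n = Fin n → Bool

count : Pred n → ℕ
count P = Σᶠ (b2n ∘ P)

infixr 6 _∩_ _∖_
_∩_ _∖_ : Pred n → Pred n → Pred n
(P ∩ Q) x = P x ∧ Q x
(P ∖ Q) x = P x ∧ not (Q x)

infix 4 _∈_ _⊆_
_∈_ : Fin n → Pred n → Set
x ∈ P = P x ≡ true

_⊆_ : Pred n → Pred n → Set
P ⊆ Q = ∀ x → x ∈ P → x ∈ Q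

∧-true : ∀ {a b} → a ∧ b ≡ true → a ≡ true × b ≡ true
∧-true {true} {true} _ = refl , refl

true-∧ : ∀ {a b} → a ≡ true → b ≡ true → a ∧ b ≡ true
true-∧ refl refl = refl

not-true : ∀ {a} → not a ≡ true → a ≢ true
not-true {false} _ ()

count-split : (P Q : Pred n) → count P ≡ count (P ∩ Q) + count (P ∖ Q)
count-split P Q = trans (Σᶠ-cong (λ x → split (P x) (Q x))) (Σᶠ-+ (b2n ∘ (P ∩ Q)) (b2n ∘ (P ∖ Q)))
  where
  split : ∀ a b → b2n a ≡ b2n (a ∧ b) + b2n (a ∧ not b)
  split true  true  = refl
  split true  false = refl
  split false _     = refl

b2n-mono : ∀ {a b} → (a ≡ true → b ≡ true) → b2n a ≤ b2n b
b2n-mono {false}         _ = z≤n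
b2n-mono {true}  {true}  _ = ℕ.≤-refl
b2n-mono {true}  {false} f = case f refl of λ ()

count-mono : {P Q : Pred n} → P ⊆ Q → count P ≤ count Q
count-mono P⊆Q = Σᶠ-mono (λ x → b2n-mono (P⊆Q x))

count-member : (P : Pred n) → 0 < count P → ∃ λ x → x ∈ P
count-member {suc n} P 0<P with P zero in eq
... | true  = zero , eq
... | false = let x , x∈P = count-member (P ∘ suc) 0<P in suc x , x∈P

b2n*-≤ : ∀ a {m k} → (a ≡ true → m ≤ k) → b2n a * m ≤ k
b2n*-≤ true  {m} m≤k = subst (_≤ _) (sym (ℕ.+-identityʳ m)) (m≤k refl)
b2n*-≤ false _   = z≤n

not-≤ᵇ : ∀ {a b} → not (a ≤ᵇ b) ≡ true → b ≤ a
not-≤ᵇ {a} {b} ¬a≤b with a ≤ᵇ b in eq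
... | false = ℕ.<⇒≤ (ℕ.≰⇒> (λ a≤b → subst T eq (ℕ.≤⇒≤ᵇ a≤b)))

≤ᵇ-true : ∀ {a b} → (a ≤ᵇ b) ≡ true → a ≤ b
≤ᵇ-true {a} {b} eq = ℕ.≤ᵇ⇒≤ a b (subst T (sym eq) _)

-- Each `u` in `P` that fails the test contributes at least `m` to `c` times the double sum on the
-- right.
markov : ∀ c m (P : Pred n) (Q : Fin n → Pred n) →
         count (P ∖ λ u → c * count (Q u) ≤ᵇ m) * m ≤ c * Σᶠ (λ u → count (λ w → P u ∧ Q u w))
markov {n} c m P Q = begin
  count (P ∖ λ u → c * count (Q u) ≤ᵇ m) * m                      ≡⟨ Σᶠ-*ʳ {n} _ m ⟨
  Σᶠ (λ u → b2n (P u ∧ not (c * count (Q u) ≤ᵇ m)) * m)           ≤⟨ Σᶠ-mono pointwise ⟩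
  Σᶠ (λ u → c * count (λ w → P u ∧ Q u w))                        ≡⟨ Σᶠ-*ˡ {n} c _ ⟩
  c * Σᶠ (λ u → count (λ w → P u ∧ Q u w))                        ∎
  where
  open ℕ.≤-Reasoning
  pointwise : ∀ u → b2n (P u ∧ not (c * count (Q u) ≤ᵇ m)) * m ≤ c * count (λ w → P u ∧ Q u w)
  pointwise u with P u
  ... | true  = b2n*-≤ (not (c * count (Q u) ≤ᵇ m)) not-≤ᵇ
  ... | false = z≤n

-- Every loss is measured against the original `P` and not against the shrinking set, so the losses
-- simply add up. Keeping them on the right-hand side avoids truncated subtraction.
refine : ∀ N (P : Pred n) (Qs : List (Pred n)) →
         All (λ Q → N * count (P ∖ Q) ≤ count P) Qs →
         ∃ λ P′ → (∀ x → x ∈ P′ → x ∈ P × All (x ∈_) Qs) ×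
                  N * count P ≤ N * count P′ + length Qs * count P
refine N P []       []       = P , (λ x x∈P → x∈P , []) , ℕ.m≤m+n _ _
refine N P (Q ∷ Qs) (h ∷ hs) with refine N P Qs hs
... | P′ , P′⊆ , size = P′ ∩ Q , P″⊆ , size″
  where
  P″⊆ : ∀ x → x ∈ P′ ∩ Q → x ∈ P × All (x ∈_) (Q ∷ Qs)
  P″⊆ x x∈ = let x∈P′ , x∈Q = ∧-true x∈ ; x∈P , x∈Qs = P′⊆ x x∈P′ in x∈P , x∈Q ∷ x∈Qs

  lost : count (P′ ∖ Q) ≤ count (P ∖ Q)
  lost = count-mono λ x x∈ → let x∈P′ , x∉Q = ∧-true x∈ in true-∧ (proj₁ (P′⊆ x x∈P′)) x∉Q

  open ℕ.≤-Reasoning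
  regroup : ∀ a b c → a + b + c ≡ a + (b + c)
  regroup = solve-∀
  size″ : N * count P ≤ N * count (P′ ∩ Q) + (count P + length Qs * count P)
  size″ = begin
    N * count P                                                       ≤⟨ size ⟩
    N * count P′ + length Qs * count P                                ≡⟨ cong (λ k → N * k + length Qs * count P) (count-split P′ Q) ⟩
    N * (count (P′ ∩ Q) + count (P′ ∖ Q)) + length Qs * count P       ≡⟨ cong (_+ length Qs * count P) (ℕ.*-distribˡ-+ N (count (P′ ∩ Q)) _) ⟩
    N * count (P′ ∩ Q) + N * count (P′ ∖ Q) + length Qs * count P     ≤⟨ ℕ.+-monoˡ-≤ _ (ℕ.+-monoʳ-≤ (N * count (P′ ∩ Q)) (ℕ.≤-trans (ℕ.*-monoʳ-≤ N lost) h)) ⟩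
    N * count (P′ ∩ Q) + count P + length Qs * count P                ≡⟨ regroup (N * count (P′ ∩ Q)) (count P) _ ⟩
    N * count (P′ ∩ Q) + (count P + length Qs * count P)              ∎

-- Forward adjacency and the table of blocks.

forward : Tournament n → Fin 10 → Fin 10 → Fin n → Pred n
forward G i j u w = if toℕ i <ᵇ toℕ j then adj G u w else
                    -- The default `true` for equal positions makes `back i i u` empty, so
                    -- typicality can range over all ten positions.
                    if toℕ j <ᵇ toℕ i then adj G w u else true

hits : Tournament n → Pred n → Pred n
hits G A x = does (Fin.any? (λ z → A z ∧ adj G x z ≟ᵇ true))

hits⁻ : ∀ (G : Tournament n) A {x} → x ∈ hits G A → ∃ λ z → z ∈ A × adj G x z ≡ true
hits⁻ G A {x} x∈ with Fin.any? (λ z → A z ∧ adj G x z ≟ᵇ true)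
... | yes (z , eq) = z , ∧-true eq

hits⁺ : ∀ (G : Tournament n) A {x z} → z ∈ A → adj G x z ≡ true → x ∈ hits G A
hits⁺ G A {x} {z} z∈A xz with Fin.any? (λ z → A z ∧ adj G x z ≟ᵇ true)
... | yes _ = refl
... | no ∄z = contradiction (z , true-∧ z∈A xz) ∄z

-- A product rather than All, because let only accepts irrefutable patterns.
FollowsAll : Tournament n → Fin 10 → Fin n → List (Fin 10 × Fin n) → Set
FollowsAll G i x []             = ⊤
FollowsAll G i x ((j , w) ∷ ps) = forward G j i w x ≡ true × FollowsAll G i x ps

followsAll : ∀ (G : Tournament n) i x {ps} → All (λ (j , w) → forward G j i w x ≡ true) ps → FollowsAll G i x ps
followsAll G i x []       = _
followsAll G i x (h ∷ hs) = h , followsAll G i x hs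

Block : Set
Block = Σ (Fin 8) λ i → Fin (blk v₀ η₀ i)

-- block k is the pair (i , a) with T_{k+1} = S_{i+1,a+1}.
block : Fin 10 → Block
block = lookup ((# 0 , # 0) ∷ (# 1 , # 0) ∷ (# 1 , # 1) ∷ (# 1 , # 2) ∷ (# 2 , # 0) ∷
                (# 3 , # 0) ∷ (# 4 , # 0) ∷ (# 5 , # 0) ∷ (# 6 , # 0) ∷ (# 7 , # 0) ∷ [])

linear : Fin 10 → Bool
linear i = not (v₀ (proj₁ (block i)))

-- 0-based: position i stands for T_{i+1}.
positions : Fin 3 → Vec (Fin 10) 7
positions zero             = # 1 ∷ # 2 ∷ # 3 ∷ # 6 ∷ # 7 ∷ # 8 ∷ # 9 ∷ []
positions (suc zero)       = # 0 ∷ # 1 ∷ # 5 ∷ # 6 ∷ # 7 ∷ # 8 ∷ # 9 ∷ []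
positions (suc (suc zero)) = # 2 ∷ # 3 ∷ # 4 ∷ # 6 ∷ # 7 ∷ # 8 ∷ # 9 ∷ []

edges : ∀ {p} → Tournament p → List (Fin p × Fin p)
edges {p} H = filterᵇ (uncurry (adj H)) (cartesianProduct (allFin p) (allFin p))

-- Only the edges of the pattern are recorded; `edges⇒≡` recovers the non-edges from them.
Copy : Tournament n → (Fin 10 → Pred n) → Set
Copy {n} G U = Σ (Fin 3) λ t → Σ (Vec (Fin n) 7) λ xs →
  Pointwise (λ i x → x ∈ U i) (positions t) xs ×
  All (λ (a , b) → adj G (lookup xs a) (lookup xs b) ≡ true) (edges (Hfam t))

-- Search for a copy in ten sparse blocks.

module _ (G : Tournament n) (U : Fin 10 → Pred n) where

  back : Fin 10 → Fin 10 → Fin n → Pred n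
  back i j u = U j ∖ forward G i j u

  backEdges : Fin 10 → Fin 10 → ℕ
  backEdges i j = Σᶠ (λ u → count (λ w → U i u ∧ back i j u w))

  -- The second clause is the bound that `refine` needs for the condition of being forward to `u`:
  -- each fixed typical vertex costs a later pool at most 1/32 of its block.
  Typical : Fin 10 → Fin n → Set
  Typical i u = u ∈ U i × (∀ j → 32 * count (back i j u) ≤ count (U j))

  -- All that the search uses about an m-sequence. `R` is the alternative outcome; it becomes the
  -- type of strong pairs.
  record Blocks (R : Set) : Set where
    field
      inhabited : ∀ i → 0 < count (U i)
      -- 1024 = 32²: by Markov's inequality at most 1/32 of U i is atypical towards any single U j.
      sparse    : ∀ i j → 1024 * backEdges i j ≤ count (U i) * count (U j)
      separate  : ∀ {i j u w} → i ≢ j → u ∈ U i → w ∈ U j → u ≢ w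
      complete  : ∀ {u w} → u ∈ U (# 1) → w ∈ U (# 3) → adj G u w ≡ true
      -- Pools are halves of their blocks, but `hitting` halves the share once more, hence the
      -- factor 4.
      crossing  : ∀ i j → i ≢ j → linear i ∨ linear j ≡ true →
                  ∀ A B → A ⊆ U i → B ⊆ U j → count (U i) ≤ 4 * count A → count (U j) ≤ 4 * count B →
                  R ⊎ ∃₂ λ a b → a ∈ A × b ∈ B × adj G b a ≡ true

  module _ {R : Set} (blocks : Blocks R) where
    open Blocks blocks

    -- 10 typicality conditions and at most 6 adjacencies, each failing on at most 1/32 of U i.
    pool : ∀ i (ps : List (Fin 10 × Fin n)) → length ps ≤ 6 → All (uncurry Typical) ps →
           ∃ λ P → (∀ x → x ∈ P → Typical i x × FollowsAll G i x ps) ×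
                   count (U i) ≤ 2 * count P
    pool i ps ∣ps∣≤6 typical = let P , P⊆ , size = refine 32 (U i) (typicals ++ map forwards ps) bounds in
      P , (λ x x∈P → members x (P⊆ x x∈P)) , halve (count (U i)) (count P) size
      where
      typicalTo : Fin 10 → Pred n
      typicalTo j u = 32 * count (back i j u) ≤ᵇ count (U j)

      forwards : Fin 10 × Fin n → Pred n
      forwards (j , w) = forward G j i w

      typicals : List (Pred n)
      typicals = map typicalTo (allFin 10)

      atypical : ∀ j → 32 * count (U i ∖ typicalTo j) ≤ count (U i)
      atypical j = ℕ.*-cancelʳ-≤ _ _ (count (U j)) {{ℕ.>-nonZero (inhabited j)}} (begin
        32 * count (U i ∖ typicalTo j) * count (U j)     ≡⟨ ℕ.*-assoc 32 (count (U i ∖ typicalTo j)) (count (U j)) ⟩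
        32 * (count (U i ∖ typicalTo j) * count (U j))   ≤⟨ ℕ.*-monoʳ-≤ 32 (markov 32 (count (U j)) (U i) (back i j)) ⟩
        32 * (32 * backEdges i j)                        ≡⟨ ℕ.*-assoc 32 32 (backEdges i j) ⟨
        1024 * backEdges i j                             ≤⟨ sparse i j ⟩
        count (U i) * count (U j)                        ∎)
        where open ℕ.≤-Reasoning

      bounds : All (λ Q → 32 * count (U i ∖ Q) ≤ count (U i)) (typicals ++ map forwards ps)
      bounds = All.++⁺ (All.map⁺ (All.tabulate {xs = allFin 10} (λ {j} _ → atypical j))) (All.map⁺ (All.map (λ (_ , few) → few i) typical))

      members : ∀ x → x ∈ U i × All (x ∈_) (typicals ++ map forwards ps) →
                Typical i x × FollowsAll G i x ps
      members x (x∈U , all) = let typ , fwd = All.++⁻ typicals all in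
        (x∈U , λ j → ≤ᵇ-true (All.lookup (All.map⁻ {f = typicalTo} typ) (∈-allFin j))) , followsAll G i x (All.map⁻ fwd)

      halve : ∀ u p → 32 * u ≤ 32 * p + length (typicals ++ map forwards ps) * u → u ≤ 2 * p
      halve u p size = ℕ.*-cancelˡ-≤ 16 (ℕ.+-cancelʳ-≤ (16 * u) _ _ (begin
        16 * u + 16 * u                                             ≡⟨ double u ⟩
        32 * u                                                      ≤⟨ size ⟩
        32 * p + (10 + length (map forwards ps)) * u                ≤⟨ ℕ.+-monoʳ-≤ (32 * p) (ℕ.*-monoˡ-≤ u (ℕ.+-monoʳ-≤ 10 ≤6)) ⟩
        32 * p + 16 * u                                             ≡⟨ cong (_+ 16 * u) (ℕ.*-assoc 16 2 p) ⟩
        16 * (2 * p) + 16 * u                                       ∎))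
        where
        open ℕ.≤-Reasoning
        double : ∀ u → 16 * u + 16 * u ≡ 32 * u
        double = solve-∀
        ≤6 : length (map forwards ps) ≤ 6
        ≤6 = subst (_≤ 6) (sym (length-map forwards ps)) ∣ps∣≤6

    quarter : ∀ i (P : Pred n) → count (U i) ≤ 2 * count P → count (U i) ≤ 4 * count P
    quarter i P half = ℕ.≤-trans half (ℕ.*-monoˡ-≤ (count P) (ℕ.m≤m+n 2 2))

    -- `B` has at least half of `U j`. If its vertices with an edge into `A` make up less than a
    -- quarter of `U j`, the others make up at least a quarter, and `crossing` finds an edge from
    -- one of them into `A`, a contradiction.
    hitting : ∀ i j → i ≢ j → linear i ∨ linear j ≡ true →
              ∀ A B → A ⊆ U i → B ⊆ U j → count (U i) ≤ 2 * count A → count (U j) ≤ 2 * count B →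
              R ⊎ ∃ λ X → (∀ x → x ∈ X → x ∈ B × ∃ λ z → z ∈ A × adj G x z ≡ true) ×
                          count (U j) ≤ 4 * count X
    hitting i j i≢j lin A B A⊆U B⊆U ∣A∣ ∣B∣ with count (U j) ℕ.≤? 4 * count (B ∩ hits G A)
    ... | yes ∣X∣ = inj₂ (B ∩ hits G A , (λ x x∈ → let x∈B , x∈hits = ∧-true x∈ in x∈B , hits⁻ G A x∈hits) , ∣X∣)
    ... | no ∣X∣ with crossing i j i≢j lin A (B ∖ hits G A) A⊆U (λ x x∈ → B⊆U x (proj₁ (∧-true x∈)))
                       (quarter i A ∣A∣) (missed (count (U j)) (count (B ∩ hits G A)) (count (B ∖ hits G A)) ∣X∣ (subst (λ b → count (U j) ≤ 2 * b) (count-split B (hits G A)) ∣B∣))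
      where
      missed : ∀ u x y → ¬ u ≤ 4 * x → u ≤ 2 * (x + y) → u ≤ 4 * y
      missed u x y u≰4x u≤ = ℕ.+-cancelˡ-≤ u _ _ (begin
        u + u                       ≤⟨ ℕ.+-mono-≤ u≤ u≤ ⟩
        2 * (x + y) + 2 * (x + y)   ≡⟨ regroup x y ⟩
        4 * x + 4 * y               ≤⟨ ℕ.+-monoˡ-≤ (4 * y) (ℕ.<⇒≤ (ℕ.≰⇒> u≰4x)) ⟩
        u + 4 * y                   ∎)
        where
        open ℕ.≤-Reasoning
        regroup : ∀ x y → 2 * (x + y) + 2 * (x + y) ≡ 4 * x + 4 * y
        regroup = solve-∀
    ...   | inj₁ r = inj₁ r
    ...   | inj₂ (z , x , z∈A , x∈ , xz) = let _ , x∉hits = ∧-true x∈ in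
      contradiction (hits⁺ G A z∈A xz) (not-true x∉hits)

    -- Bind of the exception monad: a `do` block stops at the first `R`.
    _>>=_ : {X Y : Set} → R ⊎ X → (X → R ⊎ Y) → R ⊎ Y
    inj₁ r >>= f = inj₁ r
    inj₂ x >>= f = f x

    -- p q y x w z a b c d lie in T_8 T_10 T_7 T_9 T_2 T_4 T_3 T_1 T_6 T_5.
    copy : R ⊎ Copy G U
    copy = do
      let P₈ , P₈⊆ , ∣P₈∣ = pool (# 7) [] z≤n []
          P₁₀ , P₁₀⊆ , ∣P₁₀∣ = pool (# 9) [] z≤n []
      p , q , p∈ , q∈ , qp ← cross (# 7) (# 9) (λ ()) refl P₈⊆ P₁₀⊆ ∣P₈∣ ∣P₁₀∣
      let p-typ , _ = P₈⊆ p p∈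
          q-typ , _ = P₁₀⊆ q q∈
          pq = (# 7 , p) ∷ (# 9 , q) ∷ []
          pq-typ = p-typ ∷ q-typ ∷ []
          P₂ , P₂⊆ , ∣P₂∣ = pool (# 1) pq (≤6 2) pq-typ
          P₄ , P₄⊆ , ∣P₄∣ = pool (# 3) pq (≤6 2) pq-typ
          P₇ , P₇⊆ , ∣P₇∣ = pool (# 6) pq (≤6 2) pq-typ
          P₉ , P₉⊆ , ∣P₉∣ = pool (# 8) pq (≤6 2) pq-typ
      X , X⊆ , ∣X∣ ← hitting (# 3) (# 8) (λ ()) refl P₄ P₉ (inU P₄⊆) (inU P₉⊆) ∣P₄∣ ∣P₉∣
      Y , Y⊆ , ∣Y∣ ← hitting (# 1) (# 6) (λ ()) refl P₂ P₇ (inU P₂⊆) (inU P₇⊆) ∣P₂∣ ∣P₇∣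
      -- `X` and `Y` are only known to be quarters of their blocks, so `crossing` is used directly.
      -- The edge is chosen after them, so that both of its ends already have their backward edges
      -- to `z` and `w`.
      y , x , y∈ , x∈ , xy ← crossing (# 6) (# 8) (λ ()) refl Y X
                               (λ y y∈ → inU P₇⊆ y (proj₁ (Y⊆ y y∈))) (λ x x∈ → inU P₉⊆ x (proj₁ (X⊆ x x∈))) ∣Y∣ ∣X∣
      let y∈P₇ , w , w∈P₂ , yw = Y⊆ y y∈
          x∈P₉ , z , z∈P₄ , xz = X⊆ x x∈
          w-typ , wp , wq , _ = P₂⊆ w w∈P₂
          z-typ , zp , zq , _ = P₄⊆ z z∈P₄
          y-typ , yp , yq , _ = P₇⊆ y y∈P₇
          x-typ , px , xq , _ = P₉⊆ x x∈P₉
      -- Among `w`, `z`, `y`, `x` the edges x → y, x → z and y → w are backward and w → z is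
      -- forward. Only the pairs `y`, `z` and `x`, `w` are still open.
      case either (separate (λ ()) (proj₁ y-typ) (proj₁ z-typ)) of λ where
        (inj₁ yz) → do
          let ps = (# 3 , z) ∷ (# 6 , y) ∷ (# 8 , x) ∷ pq
              ps-typ = z-typ ∷ y-typ ∷ x-typ ∷ pq-typ
              P₃ , P₃⊆ , ∣P₃∣ = pool (# 2) ps (≤6 5) ps-typ
              P₅ , P₅⊆ , ∣P₅∣ = pool (# 4) ps (≤6 5) ps-typ
          a , d , a∈ , d∈ , da ← cross (# 2) (# 4) (λ ()) refl P₃⊆ P₅⊆ ∣P₃∣ ∣P₅∣
          let a-typ , az , ay , ax , ap , aq , _ = P₃⊆ a a∈
              d-typ , zd , dy , dx , dp , dq , _ = P₅⊆ d d∈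
          inj₂ (# 2 , a ∷ z ∷ d ∷ y ∷ p ∷ x ∷ q ∷ [] ,
                proj₁ a-typ ∷ proj₁ z-typ ∷ proj₁ d-typ ∷ proj₁ y-typ ∷ proj₁ p-typ ∷ proj₁ x-typ ∷ proj₁ q-typ ∷ [] ,
                -- The edges come in lexicographic order, one row for each tail; `uv` names the
                -- proof of u → v.
                az ∷ ay ∷ ap ∷ ax ∷ aq ∷
                zd ∷ zp ∷ zq ∷
                da ∷ dy ∷ dp ∷ dx ∷ dq ∷
                yz ∷ yp ∷ yq ∷
                px ∷
                xz ∷ xy ∷ xq ∷
                qp ∷ [])
        (inj₂ zy) → case either (separate (λ ()) (proj₁ x-typ) (proj₁ w-typ)) of λ where
          (inj₁ xw) → do
            let ps = (# 1 , w) ∷ (# 6 , y) ∷ (# 8 , x) ∷ pq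
                ps-typ = w-typ ∷ y-typ ∷ x-typ ∷ pq-typ
                P₁ , P₁⊆ , ∣P₁∣ = pool (# 0) ps (≤6 5) ps-typ
                P₆ , P₆⊆ , ∣P₆∣ = pool (# 5) ps (≤6 5) ps-typ
            b , c , b∈ , c∈ , cb ← cross (# 0) (# 5) (λ ()) refl P₁⊆ P₆⊆ ∣P₁∣ ∣P₆∣
            let b-typ , bw , by , bx , bp , bq , _ = P₁⊆ b b∈
                c-typ , wc , cy , cx , cp , cq , _ = P₆⊆ c c∈
            inj₂ (# 1 , b ∷ w ∷ c ∷ y ∷ p ∷ x ∷ q ∷ [] ,
                  proj₁ b-typ ∷ proj₁ w-typ ∷ proj₁ c-typ ∷ proj₁ y-typ ∷ proj₁ p-typ ∷ proj₁ x-typ ∷ proj₁ q-typ ∷ [] ,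
                  bw ∷ by ∷ bp ∷ bx ∷ bq ∷
                  wc ∷ wp ∷ wq ∷
                  cb ∷ cy ∷ cp ∷ cx ∷ cq ∷
                  yw ∷ yp ∷ yq ∷
                  px ∷
                  xw ∷ xy ∷ xq ∷
                  qp ∷ [])
          (inj₂ wx) → do
            -- Here six vertices are already fixed, the largest number that `pool` has to allow.
            let P₃ , P₃⊆ , ∣P₃∣ = pool (# 2) ((# 1 , w) ∷ (# 3 , z) ∷ (# 6 , y) ∷ (# 8 , x) ∷ pq) (≤6 6)
                                       (w-typ ∷ z-typ ∷ y-typ ∷ x-typ ∷ pq-typ)
                a , a∈ = count-member P₃ (ℕ.*-cancelˡ-< 2 0 _ (ℕ.<-≤-trans (inhabited (# 2)) ∣P₃∣))
                a-typ , wa , az , ay , ax , ap , aq , _ = P₃⊆ a a∈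
            inj₂ (# 0 , w ∷ a ∷ z ∷ y ∷ p ∷ x ∷ q ∷ [] ,
                  proj₁ w-typ ∷ proj₁ a-typ ∷ proj₁ z-typ ∷ proj₁ y-typ ∷ proj₁ p-typ ∷ proj₁ x-typ ∷ proj₁ q-typ ∷ [] ,
                  -- `w` and `z` come from independent pools; they are joined because T_2 is
                  -- complete to T_4.
                  wa ∷ complete (proj₁ w-typ) (proj₁ z-typ) ∷ wp ∷ wx ∷ wq ∷
                  az ∷ ay ∷ ap ∷ ax ∷ aq ∷
                  zy ∷ zp ∷ zq ∷
                  yw ∷ yp ∷ yq ∷
                  px ∷
                  xz ∷ xy ∷ xq ∷
                  qp ∷ [])
      where
      either : ∀ {u w} → u ≢ w → adj G u w ≡ true ⊎ adj G w u ≡ true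
      either {u} {w} u≢w with adj G u w in uw
      ... | true  = inj₁ refl
      ... | false = inj₂ (trans (tourn G w u (u≢w ∘ sym)) (cong not uw))

      ≤6 : ∀ k → {True (k ℕ.≤? 6)} → k ≤ 6
      ≤6 k {k≤6} = toWitness k≤6

      inU : ∀ {i P} {B : Fin n → Set} → (∀ x → x ∈ P → Typical i x × B x) → P ⊆ U i
      inU P⊆ x x∈P = proj₁ (proj₁ (P⊆ x x∈P))

      cross : ∀ i j → i ≢ j → linear i ∨ linear j ≡ true → ∀ {A B} {A′ B′ : Fin n → Set} →
              (∀ x → x ∈ A → Typical i x × A′ x) → (∀ x → x ∈ B → Typical j x × B′ x) →
              count (U i) ≤ 2 * count A → count (U j) ≤ 2 * count B →
              R ⊎ ∃₂ λ a b → a ∈ A × b ∈ B × adj G b a ≡ true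
      cross i j i≢j lin {A} {B} A⊆ B⊆ ∣A∣ ∣B∣ =
        crossing i j i≢j lin A B (inU A⊆) (inU B⊆) (quarter i A ∣A∣) (quarter j B ∣B∣)

-- From rational bounds to natural numbers.

⟦⟧≡fromℤ : ∀ k → ⟦ k ⟧ ≡ ℚ.fromℤ (ℤ.+ k)
⟦⟧≡fromℤ k = ℚ.normalize-coprime _

⟦⟧-* : ∀ a b → ⟦ a * b ⟧ ≡ ⟦ a ⟧ ℚ.* ⟦ b ⟧
-- For a variable `k` the fraction `⟦ k ⟧` is stuck on its normalisation; `fromℤ` is in constructor
-- form and lets the product compute.
⟦⟧-* a b rewrite ⟦⟧≡fromℤ a | ⟦⟧≡fromℤ b = cong (ℚ._/ 1) (ℤ.pos-* a b)

⟦⟧-+ : ∀ a b → ⟦ a + b ⟧ ≡ ⟦ a ⟧ ℚ.+ ⟦ b ⟧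
⟦⟧-+ a b rewrite ⟦⟧≡fromℤ a | ⟦⟧≡fromℤ b =
  cong (ℚ._/ 1) (sym (cong₂ ℤ._+_ (ℤ.*-identityʳ (ℤ.+ a)) (ℤ.*-identityʳ (ℤ.+ b))))

⟦⟧-mono : ∀ {a b} → a ≤ b → ⟦ a ⟧ ℚ.≤ ⟦ b ⟧
⟦⟧-mono {a} {b} a≤b rewrite ⟦⟧≡fromℤ a | ⟦⟧≡fromℤ b = ℚ.*≤* (ℤ.*-monoʳ-≤-nonNeg (ℤ.+ 1) (ℤ.+≤+ a≤b))

⟦⟧-cancel : ∀ {a b} → ⟦ a ⟧ ℚ.≤ ⟦ b ⟧ → a ≤ b
⟦⟧-cancel {a} {b} a≤b rewrite ⟦⟧≡fromℤ a | ⟦⟧≡fromℤ b =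
  ℤ.drop‿+≤+ (ℤ.*-cancelʳ-≤-pos (ℤ.+ a) (ℤ.+ b) (ℤ.+ 1) (ℚ.drop-*≤* a≤b))

⟦⟧-nonNeg : ∀ k → ℚ.NonNegative ⟦ k ⟧
⟦⟧-nonNeg k = ℚ.normalize-nonNeg k 1

-- The denominator of `c` serves as `suc K`: its product with `c` is the numerator, a positive
-- integer. Unnormalised rationals avoid the reduction of that product to lowest terms.
archimedean : ∀ c → 0ℚ ℚ.< c → ∃ λ K → 1ℚ ℚ.≤ c ℚ.* ⟦ suc K ⟧
archimedean c@(mkℚ (ℤ.+_ zero) d _)   (ℚ.*<* (ℤ.+<+ ()))
archimedean c@(mkℚ (ℤ.+_ (suc p)) d _) 0<c = d , ℚ.toℚᵘ-cancel-≤ (begin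
  ℚᵘ.1ℚᵘ                                         ≤⟨ ℚᵘ.*≤* (ℤ.+≤+ bound) ⟩
  ℚ.toℚᵘ c ℚᵘ.* ℚᵘ.mkℚᵘ (ℤ.+ suc d) 0            ≃⟨ ℚᵘ.*-congˡ {ℚ.toℚᵘ c} (ℚ.toℚᵘ-fromℚᵘ (ℚᵘ.mkℚᵘ (ℤ.+ suc d) 0)) ⟨
  ℚ.toℚᵘ c ℚᵘ.* ℚ.toℚᵘ ⟦ suc d ⟧                 ≃⟨ ℚ.toℚᵘ-homo-* c ⟦ suc d ⟧ ⟨
  ℚ.toℚᵘ (c ℚ.* ⟦ suc d ⟧)                       ∎)
  where
  open ℚᵘ.≤-Reasoning
  bound : suc (d * 1 + 0) ≤ suc ((d + p * suc d) * 1)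
  bound = s≤s (subst (_≤ (d + p * suc d) * 1) (sym (ℕ.+-identityʳ (d * 1))) (ℕ.*-monoˡ-≤ 1 (ℕ.m≤m+n d (p * suc d))))
archimedean (mkℚ (ℤ.-[1+_] _) _ _) (ℚ.*<* ())

module _ {c : ℚ} where

  -- Replaces the fraction `c` by the integer factor `K`, so that the sizes of blocks can be
  -- compared in the natural numbers.
  scale : ∀ {K} → 1ℚ ℚ.≤ c ℚ.* ⟦ K ⟧ → ∀ t s → c ℚ.* ⟦ t ⟧ ℚ.≤ ⟦ s ⟧ → t ≤ K * s
  scale {K} 1≤cK t s ct≤s = ⟦⟧-cancel (begin
    ⟦ t ⟧                         ≡⟨ ℚ.*-identityˡ ⟦ t ⟧ ⟨
    1ℚ ℚ.* ⟦ t ⟧                  ≤⟨ ℚ.*-monoʳ-≤-nonNeg ⟦ t ⟧ {{⟦⟧-nonNeg t}} 1≤cK ⟩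
    c ℚ.* ⟦ K ⟧ ℚ.* ⟦ t ⟧         ≡⟨ solve 3 (λ c k t → c :* k :* t := k :* (c :* t)) refl c ⟦ K ⟧ ⟦ t ⟧ ⟩
    ⟦ K ⟧ ℚ.* (c ℚ.* ⟦ t ⟧)       ≤⟨ ℚ.*-monoˡ-≤-nonNeg ⟦ K ⟧ {{⟦⟧-nonNeg K}} ct≤s ⟩
    ⟦ K ⟧ ℚ.* ⟦ s ⟧               ≡⟨ ⟦⟧-* K s ⟨
    ⟦ K * s ⟧                     ∎)
    where
    open ℚ.≤-Reasoning

  quarter-≤ : ∀ t s a → c ℚ.* ⟦ t ⟧ ℚ.≤ ⟦ s ⟧ → s ≤ 4 * a → (c ℚ.* (ℤ.+ 1 ℚ./ 4)) ℚ.* ⟦ t ⟧ ℚ.≤ ⟦ a ⟧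
  quarter-≤ t s a ct≤s s≤4a = begin
    c ℚ.* ¼ ℚ.* ⟦ t ⟧             ≡⟨ solve 3 (λ c q t → c :* q :* t := q :* (c :* t)) refl c ¼ ⟦ t ⟧ ⟩
    ¼ ℚ.* (c ℚ.* ⟦ t ⟧)           ≤⟨ ℚ.*-monoˡ-≤-nonNeg ¼ (ℚ.≤-trans ct≤s (⟦⟧-mono s≤4a)) ⟩
    ¼ ℚ.* ⟦ 4 * a ⟧               ≡⟨ cong (¼ ℚ.*_) (⟦⟧-* 4 a) ⟩
    ¼ ℚ.* (⟦ 4 ⟧ ℚ.* ⟦ a ⟧)       ≡⟨ ℚ.*-assoc ¼ ⟦ 4 ⟧ ⟦ a ⟧ ⟨
    1ℚ ℚ.* ⟦ a ⟧                  ≡⟨ ℚ.*-identityˡ ⟦ a ⟧ ⟩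
    ⟦ a ⟧                         ∎
    where
    open ℚ.≤-Reasoning
    ¼ = ℤ.+ 1 ℚ./ 4

-- With `k` edges and `w` non-edges, w = xy - k ≤ λ'xy ≤ λ₀xy, and `λ₀` is 1/L.
density : ∀ L {λ₀ λ' : ℚ} → λ₀ ℚ.* ⟦ L ⟧ ≡ 1ℚ → λ' ℚ.≤ λ₀ → ∀ w k x y → w + k ≡ x * y →
          (1ℚ ℚ.- λ') ℚ.* (⟦ x ⟧ ℚ.* ⟦ y ⟧) ℚ.≤ ⟦ k ⟧ → L * w ≤ x * y
density L {λ₀} {λ'} λ₀L≡1 λ'≤λ₀ w k x y w+k≡xy dens = ⟦⟧-cancel (begin
  ⟦ L * w ⟧                                    ≡⟨ ⟦⟧-* L w ⟩
  ⟦ L ⟧ ℚ.* ⟦ w ⟧                              ≤⟨ ℚ.*-monoˡ-≤-nonNeg ⟦ L ⟧ {{⟦⟧-nonNeg L}} w≤ ⟩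
  ⟦ L ⟧ ℚ.* (λ₀ ℚ.* ⟦ x * y ⟧)                 ≡⟨ solve 3 (λ l m p → l :* (m :* p) := m :* l :* p) refl ⟦ L ⟧ λ₀ ⟦ x * y ⟧ ⟩
  λ₀ ℚ.* ⟦ L ⟧ ℚ.* ⟦ x * y ⟧                   ≡⟨ cong (ℚ._* ⟦ x * y ⟧) λ₀L≡1 ⟩
  1ℚ ℚ.* ⟦ x * y ⟧                             ≡⟨ ℚ.*-identityˡ ⟦ x * y ⟧ ⟩
  ⟦ x * y ⟧                                    ∎)
  where
  open ℚ.≤-Reasoning
  w≤ : ⟦ w ⟧ ℚ.≤ λ₀ ℚ.* ⟦ x * y ⟧
  w≤ = begin
    ⟦ w ⟧                                              ≡⟨ solve 2 (λ w k → w := w :+ k :- k) refl ⟦ w ⟧ ⟦ k ⟧ ⟩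
    ⟦ w ⟧ ℚ.+ ⟦ k ⟧ ℚ.- ⟦ k ⟧                          ≡⟨ cong (ℚ._- ⟦ k ⟧) (⟦⟧-+ w k) ⟨
    ⟦ w + k ⟧ ℚ.- ⟦ k ⟧                                ≡⟨ cong (λ m → ⟦ m ⟧ ℚ.- ⟦ k ⟧) w+k≡xy ⟩
    ⟦ x * y ⟧ ℚ.- ⟦ k ⟧                                ≤⟨ ℚ.+-monoʳ-≤ ⟦ x * y ⟧ (ℚ.neg-antimono-≤ dens) ⟩
    ⟦ x * y ⟧ ℚ.- (1ℚ ℚ.- λ') ℚ.* (⟦ x ⟧ ℚ.* ⟦ y ⟧)    ≡⟨ cong (λ m → ⟦ x * y ⟧ ℚ.- (1ℚ ℚ.- λ') ℚ.* m) (⟦⟧-* x y) ⟨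
    ⟦ x * y ⟧ ℚ.- (1ℚ ℚ.- λ') ℚ.* ⟦ x * y ⟧            ≡⟨ solve 2 (λ l m → m :- (con 1ℚ :- l) :* m := l :* m) refl λ' ⟦ x * y ⟧ ⟩
    λ' ℚ.* ⟦ x * y ⟧                                   ≤⟨ ℚ.*-monoʳ-≤-nonNeg ⟦ x * y ⟧ {{⟦⟧-nonNeg (x * y)}} λ'≤λ₀ ⟩
    λ₀ ℚ.* ⟦ x * y ⟧                                   ∎

-- Cardinalities, densities and transitive sets.

card : (X : Subset n) → ∣ X ∣ ≡ count (lookup X)
card []          = refl
card (true ∷ X)  = cong suc (card X)
card (false ∷ X) = card X

-- Counts non-edges, not reversed edges, so that missing+e needs no disjointness.
missing : Tournament n → Pred n → Pred n → ℕ
missing G X Y = Σᶠ (λ u → count (λ w → X u ∧ (Y w ∧ not (adj G u w))))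

missing+e : ∀ (G : Tournament n) X Y → missing G (lookup X) (lookup Y) + e G X Y ≡ ∣ X ∣ * ∣ Y ∣
missing+e {n} G X Y = begin
  missing G (lookup X) (lookup Y) + e G X Y                                ≡⟨ Σᶠ-+ {n} _ _ ⟨
  Σᶠ (λ u → count (λ w → lookup X u ∧ (lookup Y w ∧ not (adj G u w))) +
            count (λ w → lookup X u ∧ (lookup Y w ∧ adj G u w)))           ≡⟨ Σᶠ-cong {n} row ⟩
  Σᶠ (λ u → b2n (lookup X u) * ∣ Y ∣)                                      ≡⟨ Σᶠ-*ʳ {n} _ ∣ Y ∣ ⟩
  count (lookup X) * ∣ Y ∣                                                 ≡⟨ cong (_* ∣ Y ∣) (card X) ⟨
  ∣ X ∣ * ∣ Y ∣                                                            ∎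
  where
  open ≡-Reasoning
  split : ∀ a b c → b2n (a ∧ (b ∧ not c)) + b2n (a ∧ (b ∧ c)) ≡ b2n a * b2n b
  split false _     _     = refl
  split true  false _     = refl
  split true  true  false = refl
  split true  true  true  = refl

  row : ∀ u → count (λ w → lookup X u ∧ (lookup Y w ∧ not (adj G u w))) +
              count (λ w → lookup X u ∧ (lookup Y w ∧ adj G u w)) ≡ b2n (lookup X u) * ∣ Y ∣
  row u = begin
    _                                                     ≡⟨ Σᶠ-+ {n} _ _ ⟨
    Σᶠ (λ w → b2n (lookup X u ∧ (lookup Y w ∧ not (adj G u w))) +
              b2n (lookup X u ∧ (lookup Y w ∧ adj G u w))) ≡⟨ Σᶠ-cong {n} (λ w → split (lookup X u) (lookup Y w) (adj G u w)) ⟩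
    Σᶠ (λ w → b2n (lookup X u) * b2n (lookup Y w))        ≡⟨ Σᶠ-*ˡ {n} (b2n (lookup X u)) _ ⟩
    b2n (lookup X u) * count (lookup Y)                   ≡⟨ cong (b2n (lookup X u) *_) (card Y) ⟨
    b2n (lookup X u) * ∣ Y ∣                              ∎

Σᶠ-≡0 : {f : Fin n → ℕ} → (∀ i → f i ≡ 0) → Σᶠ f ≡ 0
Σᶠ-≡0 {n} f≡0 = trans (Σᶠ-cong f≡0) (Σᶠ-0 n)

count-empty : {P : Pred n} → (∀ x → P x ≢ true) → count P ≡ 0
count-empty P≢ = Σᶠ-≡0 (λ x → cong b2n (¬-not (P≢ x)))

missing-none : ∀ (G : Tournament n) X Y → (∀ u w → u ∈ X → w ∈ Y → adj G u w ≡ true) → missing G X Y ≡ 0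
missing-none G X Y all = Σᶠ-≡0 (λ u → count-empty (λ w uw∈ →
  let u∈X , yw∈ = ∧-true uw∈ ; w∈Y , ¬uw = ∧-true yw∈ in not-true ¬uw (all u w u∈X w∈Y)))

missing-mono : ∀ (G : Tournament n) {X X′ Y Y′} → X ⊆ X′ → Y ⊆ Y′ → missing G X Y ≤ missing G X′ Y′
missing-mono G X⊆X′ Y⊆Y′ = Σᶠ-mono (λ u → count-mono (λ w uw∈ →
  let u∈X , yw∈ = ∧-true uw∈ ; w∈Y , ¬uw = ∧-true yw∈ in true-∧ (X⊆X′ u u∈X) (true-∧ (Y⊆Y′ w w∈Y) ¬uw)))

-- For i < j the backward edges are the non-edges from `U i` to `U j`; for j < i the double sum is
-- transposed; for equal positions it is zero.
backEdges-≤ : ∀ (G : Tournament n) (U : Fin 10 → Pred n) →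
              (∀ i j → i Fin.< j → 1024 * missing G (U i) (U j) ≤ count (U i) * count (U j)) →
              ∀ i j → 1024 * backEdges G U i j ≤ count (U i) * count (U j)
backEdges-≤ {n} G U sparse i j with toℕ i <ᵇ toℕ j in i<j | toℕ j <ᵇ toℕ i in j<i
... | true  | _     = sparse i j (ℕ.<ᵇ⇒< (toℕ i) (toℕ j) (subst T (sym i<j) _))
... | false | true  = subst₂ _≤_ (cong (1024 *_) transpose) (ℕ.*-comm (count (U j)) (count (U i)))
                             (sparse j i (ℕ.<ᵇ⇒< (toℕ j) (toℕ i) (subst T (sym j<i) _)))
  where
  ∧-exchange : ∀ a b c → a ∧ (b ∧ c) ≡ b ∧ (a ∧ c)
  ∧-exchange true  _     _ = refl
  ∧-exchange false true  _ = refl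
  ∧-exchange false false _ = refl

  transpose : missing G (U j) (U i) ≡ Σᶠ (λ u → count (λ w → U i u ∧ (U j w ∧ not (adj G w u))))
  transpose = trans (Σᶠ-swap {n} {n} _) (Σᶠ-cong {n} (λ u → Σᶠ-cong {n} (λ w → cong b2n (∧-exchange (U j w) (U i u) _))))
... | false | false = subst (λ k → 1024 * k ≤ count (U i) * count (U j)) (sym none) z≤n
  where
  none : Σᶠ (λ u → count (λ w → U i u ∧ (U j w ∧ false))) ≡ 0
  none = Σᶠ-≡0 {n} (λ u → count-empty {n} (λ w uw∈ → not-true (proj₂ (∧-true {U j w} {not true} (proj₂ (∧-true {U i u} uw∈)))) refl))

-- tr(T) is only used to prove decidable inequalities, so its double-negated existence is enough.
¬¬IsTr : (G : Tournament n) → ¬ ¬ ∃ (IsTr G)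
¬¬IsTr {n} G ∄t = unbounded n Subset.⊥ (ℕ.m≤m+n n _) λ (m , w , _ , w∈⊥ , _) → Subset.∉⊥ (w∈⊥ zero)
  where
  -- Without a maximum every transitive set is beaten by a larger one. `k` bounds how much `S` can
  -- still grow, so the descent, started at the empty set, ends.
  unbounded : ∀ k (S : Subset n) → n ≤ k + ∣ S ∣ → ¬ Transitive G S
  unbounded k S n≤ S-tr = ∄t (∣ S ∣ , (S , S-tr , refl) , λ S′ S′-tr → ℕ.≮⇒≥ (bigger k n≤ S′ S′-tr))
    where
    bigger : ∀ k → n ≤ k + ∣ S ∣ → ∀ S′ → Transitive G S′ → ¬ (∣ S ∣ < ∣ S′ ∣)
    bigger zero    n≤∣S∣ S′ S′-tr S<S′ = ℕ.<⇒≱ S<S′ (ℕ.≤-trans (Subset.∣p∣≤n S′) n≤∣S∣)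
    bigger (suc k) n≤ S′ S′-tr S<S′ = unbounded k S′ (ℕ.≤-trans n≤ (subst (_≤ k + ∣ S′ ∣) (ℕ.+-suc k ∣ S ∣) (ℕ.+-monoʳ-≤ k S<S′))) S′-tr

Transitive-⊆ : ∀ (G : Tournament n) {S S′} → S′ Subset.⊆ S → Transitive G S → Transitive G S′
Transitive-⊆ G S′⊆S S-tr (m , w , inj , w∈ , edges , back) = S-tr (m , w , inj , (λ i → S′⊆S (w∈ i)) , edges , back)

reciprocal : ∀ k .{{_ : NonZero k}} → ∃ λ q → 0ℚ ℚ.< q × q ℚ.* ⟦ k ⟧ ≡ 1ℚ
reciprocal k = ℚ.1/ ⟦ k ⟧ , ℚ.positive⁻¹ (ℚ.1/ ⟦ k ⟧) {{ℚ.1/pos⇒pos ⟦ k ⟧}} , ℚ.*-inverseˡ ⟦ k ⟧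
  where
  instance
    positive : ℚ.Positive ⟦ k ⟧
    positive = ℚ.normalize-pos k 1
    nonZero : ℚ.NonZero ⟦ k ⟧
    nonZero = ℚ.pos⇒nonZero ⟦ k ⟧

-- Order and labels of the ten blocks.

true⊎false : ∀ b → b ≡ true ⊎ b ≡ false
true⊎false true  = inj₁ refl
true⊎false false = inj₂ refl

-- inner assumes v₀ s ≡ true because only then are the parts of S_s known to be disjoint and complete.
data Precedes : Block → Block → Set where
  earlier : ∀ {s t} {a b} → s Fin.< t → Precedes (s , a) (t , b)
  inner   : ∀ {s} {a b} → v₀ s ≡ true → a Fin.< b → Precedes (s , a) (s , b)

-- Only positive answers are used, so `Maybe` suffices and no refutation has to be built.
precedes? : ∀ p q → Maybe (Precedes p q)
precedes? (s , a) (t , b) with s Fin.<? t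
... | yes s<t = just (earlier s<t)
... | no _ with s Fin.≟ t
...   | no _ = nothing
...   | yes refl with v₀ s ≟ᵇ true | a Fin.<? b
...     | yes vs | yes a<b = just (inner vs a<b)
...     | _      | _       = nothing

precedes : ∀ i j → i Fin.< j → Precedes (block i) (block j)
precedes i j i<j = to-witness-T (precedes? (block i) (block j)) (table i j i<j)
  where
  table : ∀ i j → i Fin.< j → T (is-just (precedes? (block i) (block j)))
  table = toWitness {a? = Fin.all? λ i → Fin.all? λ j → i Fin.<? j →-dec T? (is-just (precedes? (block i) (block j)))} _

-- Ties the tables `block` and `positions` to the 1-based indices in `InLong` and `Ffam`, by
-- evaluation at every vertex.
label : ∀ t h → let i , a = block (lookup (positions t) h) in offset v₀ η₀ i + toℕ a + 1 ≡ Ffam t h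
label zero             = toWitness {a? = Fin.all? λ h → _ ℕ.≟ _} _
label (suc zero)       = toWitness {a? = Fin.all? λ h → _ ℕ.≟ _} _
label (suc (suc zero)) = toWitness {a? = Fin.all? λ h → _ ℕ.≟ _} _

-- From matched edges to induced embeddings.

along-edge : ∀ {p} (H : Tournament p) {Q : Fin p × Fin p → Set} → All Q (edges H) →
             ∀ a b → adj H a b ≡ true → Q (a , b)
along-edge H all a b ab = All.lookup all
  (∈-filter⁺ (T? ∘ uncurry (adj H)) (∈-cartesianProduct⁺ (∈-allFin a) (∈-allFin b)) (subst T (sym ab) _))

-- Adjacencies need only be matched along the edges of H: a non-edge is a reversed edge or a loop.
edges⇒≡ : ∀ {p} (H : Tournament p) (G : Tournament n) (x : Fin p → Fin n) →
          All (λ (a , b) → adj G (x a) (x b) ≡ true) (edges H) → ∀ a b → adj H a b ≡ adj G (x a) (x b)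
edges⇒≡ H G x all a b with adj H a b in ab
... | true = sym (along-edge H all a b ab)
... | false with a Fin.≟ b
...   | yes refl = sym (irrefl G (x a))
...   | no a≢b   = sym (trans (tourn G (x a) (x b) xa≢xb) (cong not ba))
  where
  ba : adj G (x b) (x a) ≡ true
  ba = along-edge H all b a (trans (tourn H b a (a≢b ∘ sym)) (cong not ab))
  xa≢xb : x a ≢ x b
  xa≢xb xa≡xb = contradiction (trans (sym ba) (trans (cong (λ z → adj G z (x a)) (sym xa≡xb)) (irrefl G (x a)))) λ ()

-- If two distinct vertices had the same image, a loop of `G`, which is never an edge, would make
-- both directions between them non-edges of `H`.
reflects⇒injective : ∀ {p} (H : Tournament p) (G : Tournament n) (x : Fin p → Fin n) →
                     (∀ a b → adj H a b ≡ adj G (x a) (x b)) → Injective _≡_ _≡_ x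
reflects⇒injective H G x iso {a} {b} xa≡xb with a Fin.≟ b
... | yes a≡b = a≡b
... | no a≢b  = contradiction (trans (sym (none a b xa≡xb)) (trans (tourn H a b a≢b) (cong not (none b a (sym xa≡xb))))) λ ()
  where
  none : ∀ a b → x a ≡ x b → adj H a b ≡ false
  none a b eq = trans (iso a b) (trans (cong (adj G (x a)) (sym eq)) (irrefl G (x a)))

card-tabulate : (P : Pred n) → ∣ tabulate P ∣ ≡ count P
card-tabulate P = trans (card (tabulate P)) (Σᶠ-cong (λ x → cong b2n (Vec.lookup∘tabulate P x)))

tabulate⊆ : (X : Subset n) {P : Pred n} → P ⊆ lookup X → tabulate P Subset.⊆ X
tabulate⊆ X {P} P⊆X {x} x∈ = Vec.lookup⇒[]= x X (P⊆X x (trans (sym (Vec.lookup∘tabulate P x)) (Vec.[]=⇒lookup x∈)))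

-- The blocks of an m-sequence.

module _ {G : Tournament n} {c λ' : ℚ} (χ : MSeq G v₀ η₀ c λ') where

  piece : Block → Subset n
  piece (i , a) = part χ i a

  U : Fin 10 → Pred n
  U k = lookup (piece (block k))

  piece⊆S : ∀ p → piece p Subset.⊆ S χ (proj₁ p)
  piece⊆S (i , a) {x} x∈ with true⊎false (v₀ i)
  ... | inj₁ vi = let _ , _ , ⊆S , _ = case1 χ i vi in ⊆S a x x∈
  ... | inj₂ vi = let _ , ≡S = case0 χ i vi in subst (x Subset.∈_) (≡S a) x∈

  -- Nonemptiness is part of `DensAtLeast`; the density bounds that involve the first set cover all
  -- eight sets.
  S-nonempty : ∀ i → Nonempty (S χ i)
  S-nonempty zero    = proj₁ (S-dens χ zero (suc zero) (s≤s z≤n))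
  S-nonempty (suc i) = proj₁ (proj₂ (S-dens χ zero (suc i) (s≤s z≤n)))

  pieces-disjoint : ∀ {p q x y} → Precedes p q → x Subset.∈ piece p → y Subset.∈ piece q → x ≢ y
  pieces-disjoint {p} {q} (earlier s<t) x∈ y∈ refl =
    S-disj χ _ _ (Fin.<⇒≢ s<t) (_ , Subset.x∈p∩q⁺ (piece⊆S p x∈ , piece⊆S q y∈))
  pieces-disjoint (inner {s} vs a<b) x∈ y∈ refl =
    let _ , _ , _ , disj , _ = case1 χ s vs in disj _ _ (Fin.<⇒≢ a<b) (_ , Subset.x∈p∩q⁺ (x∈ , y∈))

  module _ {K : ℕ} (1≤cK : 1ℚ ℚ.≤ c ℚ.* ⟦ K ⟧)
           {c₂ : ℚ} (quartering : ∀ t s a → c ℚ.* ⟦ t ⟧ ℚ.≤ ⟦ s ⟧ → s ≤ 4 * a → c₂ ℚ.* ⟦ t ⟧ ℚ.≤ ⟦ a ⟧) where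

    -- If v(i) = 0, the piece is S_i itself and has at least n/K vertices; if v(i) = 1, the
    -- transitive set S_i has at most tr(T) vertices and the piece at least tr(T)/K.
    ∣S∣≤K∣piece∣ : ∀ p → ∣ S χ (proj₁ p) ∣ ≤ K * ∣ piece p ∣
    ∣S∣≤K∣piece∣ (i , a) with true⊎false (v₀ i)
    ... | inj₂ vi = ℕ.≤-trans (Subset.∣p∣≤n (S χ i)) (scale {c} {K} 1≤cK n ∣ part χ i a ∣ (subst (λ X → c ℚ.* ⟦ n ⟧ ℚ.≤ ⟦ ∣ X ∣ ⟧) (sym (proj₂ (case0 χ i vi) a)) (proj₁ (case0 χ i vi))))
    ... | inj₁ vi = let S-tr , _ , _ , _ , _ , large = case1 χ i vi in
      decidable-stable (_ ℕ.≤? _) λ ≰ → ¬¬IsTr G λ (t , isTr) →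
        ≰ (ℕ.≤-trans (proj₂ isTr _ S-tr) (scale {c} {K} 1≤cK t ∣ part χ i a ∣ (large a t isTr)))

    piece-inhabited : ∀ p → 0 < ∣ piece p ∣
    piece-inhabited p = ℕ.n≢0⇒n>0 λ ∣p∣≡0 →
      ℕ.<⇒≱ (nonempty-size (S χ (proj₁ p)) (S-nonempty (proj₁ p)))
            (subst (∣ S χ (proj₁ p) ∣ ≤_) (trans (cong (K *_) ∣p∣≡0) (ℕ.*-zeroʳ K)) (∣S∣≤K∣piece∣ p))
      where
      nonempty-size : ∀ (X : Subset n) → Nonempty X → 0 < ∣ X ∣
      nonempty-size X (x , x∈X) = subst (_≤ ∣ X ∣) (Subset.∣⁅x⁆∣≡1 x) (Subset.p⊆q⇒∣p∣≤∣q∣ (λ y∈ → subst (Subset._∈ X) (sym (Subset.x∈⁅y⁆⇒x≡y x y∈)) x∈X))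

    -- Each piece is at least 1/K of its S_i, so passing to pieces multiplies the proportion of
    -- non-edges by at most K². This is the origin of `K * K` in the choice of `λ₀`. Two pieces of
    -- the same S_i have no non-edges in their order.
    pieces-sparse : {{NonZero K}} → ∀ {λ₀} → λ₀ ℚ.* ⟦ 1024 * (K * K) ⟧ ≡ 1ℚ → λ' ℚ.≤ λ₀ →
                    ∀ {p q} → Precedes p q →
                    1024 * missing G (lookup (piece p)) (lookup (piece q)) ≤ ∣ piece p ∣ * ∣ piece q ∣
    pieces-sparse λ₀≡ λ'≤λ₀ {p} {q} (inner {s} vs a<b) =
      subst (_≤ ∣ piece p ∣ * ∣ piece q ∣) (sym (cong (1024 *_) none)) z≤n
      where
      none : missing G (lookup (piece p)) (lookup (piece q)) ≡ 0
      none = let _ , _ , _ , _ , complete , _ = case1 χ s vs in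
        missing-none G (lookup (piece p)) (lookup (piece q)) λ u w u∈ w∈ → complete _ _ a<b u w (Vec.lookup⇒[]= u (piece p) u∈) (Vec.lookup⇒[]= w (piece q) w∈)
    pieces-sparse λ₀≡ λ'≤λ₀ {p} {q} (earlier {s} {t} s<t) =
      ℕ.*-cancelˡ-≤ (K * K) {{ℕ.m*n≢0 K K}} (begin
        K * K * (1024 * missing G (lookup (piece p)) (lookup (piece q)))   ≡⟨ regroup K (missing G (lookup (piece p)) (lookup (piece q))) ⟩
        1024 * (K * K) * missing G (lookup (piece p)) (lookup (piece q))   ≤⟨ ℕ.*-monoʳ-≤ (1024 * (K * K)) (missing-mono G (piece⊆ p) (piece⊆ q)) ⟩
        1024 * (K * K) * missing G (lookup (S χ s)) (lookup (S χ t))       ≤⟨ S-sparse ⟩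
        ∣ S χ s ∣ * ∣ S χ t ∣                                              ≤⟨ ℕ.*-mono-≤ (∣S∣≤K∣piece∣ p) (∣S∣≤K∣piece∣ q) ⟩
        K * ∣ piece p ∣ * (K * ∣ piece q ∣)                                ≡⟨ collect K ∣ piece p ∣ ∣ piece q ∣ ⟩
        K * K * (∣ piece p ∣ * ∣ piece q ∣)                                ∎)
      where
      open ℕ.≤-Reasoning
      regroup : ∀ K m → K * K * (1024 * m) ≡ 1024 * (K * K) * m
      regroup K m = trans (sym (ℕ.*-assoc (K * K) 1024 m)) (cong (_* m) (ℕ.*-comm (K * K) 1024))
      collect : ∀ k a b → k * a * (k * b) ≡ k * k * (a * b)
      collect = solve-∀
      piece⊆ : ∀ p → lookup (piece p) ⊆ lookup (S χ (proj₁ p))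
      piece⊆ p x x∈ = Vec.[]=⇒lookup (piece⊆S p (Vec.lookup⇒[]= x (piece p) x∈))
      S-sparse : 1024 * (K * K) * missing G (lookup (S χ s)) (lookup (S χ t)) ≤ ∣ S χ s ∣ * ∣ S χ t ∣
      S-sparse = density (1024 * (K * K)) λ₀≡ λ'≤λ₀ (missing G (lookup (S χ s)) (lookup (S χ t))) (e G (S χ s) (S χ t))
                   ∣ S χ s ∣ ∣ S χ t ∣ (missing+e G (S χ s) (S χ t))
                   (proj₂ (proj₂ (S-dens χ s t s<t)))

    ∣U∣ : ∀ k → ∣ piece (block k) ∣ ≡ count (U k)
    ∣U∣ k = card (piece (block k))

    ∣piece∣≤4∣tabulate∣ : ∀ k (A : Pred n) → count (U k) ≤ 4 * count A → ∣ piece (block k) ∣ ≤ 4 * ∣ tabulate A ∣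
    ∣piece∣≤4∣tabulate∣ k A = subst₂ _≤_ (sym (∣U∣ k)) (cong (4 *_) (sym (card-tabulate A)))

    tabulate⊆piece : ∀ k {A} → A ⊆ U k → tabulate A Subset.⊆ piece (block k)
    tabulate⊆piece k = tabulate⊆ (piece (block k))

    U-separate : ∀ {i j x y} → i ≢ j → x ∈ U i → y ∈ U j → x ≢ y
    U-separate {i} {j} {x} {y} i≢j x∈ y∈ with Fin.<-cmp i j
    ... | tri< i<j _ _ = pieces-disjoint (precedes i j i<j) (Vec.lookup⇒[]= x _ x∈) (Vec.lookup⇒[]= y _ y∈)
    ... | tri≈ _ i≡j _ = contradiction i≡j i≢j
    ... | tri> _ _ j<i = pieces-disjoint (precedes j i j<i) (Vec.lookup⇒[]= y _ y∈) (Vec.lookup⇒[]= x _ x∈) ∘ sym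

    quarter-linear : ∀ k A → linear k ≡ true → count (U k) ≤ 4 * count A → c₂ ℚ.* ⟦ n ⟧ ℚ.≤ ⟦ ∣ tabulate A ∣ ⟧
    quarter-linear k A lin ∣A∣ = let large , ≡S = case0 χ i vi in
      quartering n ∣ piece (block k) ∣ ∣ tabulate A ∣ (subst (λ X → c ℚ.* ⟦ n ⟧ ℚ.≤ ⟦ ∣ X ∣ ⟧) (sym (≡S _)) large) (∣piece∣≤4∣tabulate∣ k A ∣A∣)
      where
      i = proj₁ (block k)
      vi : v₀ i ≡ false
      vi = not-injective lin

    quarter-transitive : ∀ k A → v₀ (proj₁ (block k)) ≡ true → A ⊆ U k → count (U k) ≤ 4 * count A →
                         Transitive G (tabulate A) × AtLeastTr G c₂ ∣ tabulate A ∣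
    quarter-transitive k A vi A⊆ ∣A∣ = let S-tr , _ , _ , _ , _ , large = case1 χ _ vi in
      Transitive-⊆ G (λ x∈ → piece⊆S (block k) (tabulate⊆piece k {A} A⊆ x∈)) S-tr ,
      λ t isTr → quartering t ∣ piece (block k) ∣ ∣ tabulate A ∣ (large _ t isTr) (∣piece∣≤4∣tabulate∣ k A ∣A∣)

    quarter-large : ∀ k A → A ⊆ U k → count (U k) ≤ 4 * count A →
                    (c₂ ℚ.* ⟦ n ⟧ ℚ.≤ ⟦ ∣ tabulate A ∣ ⟧) ⊎ (Transitive G (tabulate A) × AtLeastTr G c₂ ∣ tabulate A ∣)
    quarter-large k A A⊆ ∣A∣ with true⊎false (v₀ (proj₁ (block k)))
    ... | inj₁ vi = inj₂ (quarter-transitive k A vi A⊆ ∣A∣)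
    ... | inj₂ vi = inj₁ (quarter-linear k A (cong not vi) ∣A∣)

    U-inhabited : ∀ k → 0 < count (U k)
    U-inhabited k = subst (0 <_) (∣U∣ k) (piece-inhabited (block k))

    -- The first set of a strong pair must be a fixed proportion of all vertices, so it is taken in
    -- the linear block; the second may instead be transitive.
    strongPair : ∀ i j → i ≢ j → linear i ≡ true →
                 ∀ A B → A ⊆ U i → B ⊆ U j → count (U i) ≤ 4 * count A → count (U j) ≤ 4 * count B →
                 DensOne G (tabulate A) (tabulate B) ⊎ DensOne G (tabulate B) (tabulate A) → StrongPair χ c₂
    strongPair i j i≢j lin A B A⊆ B⊆ ∣A∣ ∣B∣ dense =
      tabulate A , tabulate B , disjoint , inV i A A⊆ , inV j B B⊆ ,
      quarter-linear i A lin ∣A∣ , quarter-large j B B⊆ ∣B∣ , dense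
      where
      inV : ∀ k A → A ⊆ U k → ∀ x → x Subset.∈ tabulate A → InV χ x
      inV k A A⊆ x x∈ = proj₁ (block k) , piece⊆S (block k) (tabulate⊆piece k {A} A⊆ x∈)

      disjoint : Disjoint (tabulate A) (tabulate B)
      disjoint (x , x∈) = let x∈A , x∈B = Subset.x∈p∩q⁻ (tabulate A) (tabulate B) x∈ in
        U-separate i≢j (Vec.[]=⇒lookup (tabulate⊆piece i {A} A⊆ x∈A)) (Vec.[]=⇒lookup (tabulate⊆piece j {B} B⊆ x∈B)) refl

    -- If no edge leads from `B` to `A`, then `A` is complete to `B`, and two sets of this size form
    -- a strong pair.
    crossing : ∀ i j → i ≢ j → linear i ∨ linear j ≡ true →
               ∀ A B → A ⊆ U i → B ⊆ U j → count (U i) ≤ 4 * count A → count (U j) ≤ 4 * count B →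
               StrongPair χ c₂ ⊎ ∃₂ λ a b → a ∈ A × b ∈ B × adj G b a ≡ true
    crossing i j i≢j lin A B A⊆ B⊆ ∣A∣ ∣B∣ =
      case Fin.any? (λ a → Fin.any? (λ b → A a ∧ (B b ∧ adj G b a) ≟ᵇ true)) of λ where
        (yes (a , b , ab∈)) → let a∈ , b∈ba = ∧-true ab∈ ; b∈ , ba = ∧-true b∈ba in inj₂ (a , b , a∈ , b∈ , ba)
        (no ∄)              → inj₁ (strong λ a b a∈ b∈ ba → ∄ (a , b , true-∧ a∈ (true-∧ b∈ ba)))
      where
      dense : (∀ a b → a ∈ A → b ∈ B → adj G b a ≢ true) → DensOne G (tabulate A) (tabulate B)
      dense ∄ = inhabited i A ∣A∣ , inhabited j B ∣B∣ ,
                trans (cong (_+ e G (tabulate A) (tabulate B)) (sym none)) (missing+e G (tabulate A) (tabulate B))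
        where
        inhabited : ∀ k (A : Pred n) → count (U k) ≤ 4 * count A → Nonempty (tabulate A)
        inhabited k A ∣A∣ = let a , a∈ = count-member A (ℕ.*-cancelˡ-< 4 0 _ (ℕ.<-≤-trans (U-inhabited k) ∣A∣))
                            in a , Vec.lookup⇒[]= a (tabulate A) (trans (Vec.lookup∘tabulate A a) a∈)
        A⇒B : ∀ a b → a ∈ A → b ∈ B → adj G a b ≡ true
        A⇒B a b a∈ b∈ = trans (tourn G a b (U-separate i≢j (A⊆ a a∈) (B⊆ b b∈))) (cong not (¬-not (∄ a b a∈ b∈)))

        none : missing G (lookup (tabulate A)) (lookup (tabulate B)) ≡ 0
        none = missing-none G (lookup (tabulate A)) (lookup (tabulate B)) λ a b a∈ b∈ → A⇒B a b (trans (sym (Vec.lookup∘tabulate A a)) a∈) (trans (sym (Vec.lookup∘tabulate B b)) b∈)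

      strong : (∀ a b → a ∈ A → b ∈ B → adj G b a ≢ true) → StrongPair χ c₂
      strong ∄ = case true⊎false (linear i) of λ where
        (inj₁ lin-i)  → strongPair i j i≢j lin-i A B A⊆ B⊆ ∣A∣ ∣B∣ (inj₁ (dense ∄))
        -- Now `U j` is the linear block, so `B` becomes the first set and the density one is the
        -- reverse one.
        (inj₂ ¬lin-i) → strongPair j i (i≢j ∘ sym) (trans (cong (_∨ linear j) (sym ¬lin-i)) lin) B A B⊆ A⊆ ∣B∣ ∣A∣ (inj₂ (dense ∄))

    blocks : {{NonZero K}} → ∀ {λ₀} → λ₀ ℚ.* ⟦ 1024 * (K * K) ⟧ ≡ 1ℚ → λ' ℚ.≤ λ₀ → Blocks G U (StrongPair χ c₂)
    blocks λ₀≡ λ'≤λ₀ = record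
      { inhabited = U-inhabited
      ; sparse    = backEdges-≤ G U λ i j i<j → subst (1024 * missing G (U i) (U j) ≤_)
                      (cong₂ _*_ (∣U∣ i) (∣U∣ j)) (pieces-sparse λ₀≡ λ'≤λ₀ (precedes i j i<j))
      ; separate  = U-separate
      -- T_2 and T_4 are the first and third parts of the transitive set S_2.
      ; complete  = λ {u} {w} u∈ w∈ → let _ , _ , _ , _ , complete , _ = case1 χ (# 1) refl in
                      complete (# 0) (# 2) (s≤s z≤n) u w (Vec.lookup⇒[]= u _ u∈) (Vec.lookup⇒[]= w _ w∈)
      ; crossing  = crossing
      }

-- Embeddings and the choice of constants.

Embedding : ∀ {G : Tournament n} {c λ' : ℚ} → MSeq G v₀ η₀ c λ' → Fin 3 → Set
Embedding {n} {G} χ t = Σ (Fin 7 → Fin n) λ x → Injective _≡_ _≡_ x × (∀ h → InLong χ (Ffam t h) (x h)) ×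
                                                (∀ a b → adj (Hfam t) a b ≡ adj G (x a) (x b))

embedding : ∀ {G : Tournament n} {c λ' : ℚ} (χ : MSeq G v₀ η₀ c λ') → Copy G (U χ) → ∃ (Embedding χ)
embedding {G = G} χ (t , xs , xs∈ , xs-edges) =
  t , lookup xs , reflects⇒injective (Hfam t) G (lookup xs) iso ,
  (λ h → let i , a = block (lookup (positions t) h) in
         i , a , label t h , Vec.lookup⇒[]= (lookup xs h) (part χ i a) (Pointwise.lookup xs∈ h)) ,
  iso
  where
  iso : ∀ a b → adj (Hfam t) a b ≡ adj G (lookup xs a) (lookup xs b)
  iso = edges⇒≡ (Hfam t) G (lookup xs) xs-edges

theorem21 : StrongEH 3 Hsize Hfam Ffam v₀ η₀
theorem21 c 0<c =
  -- `λ₀` is 1/(1024 (K + 1)²), which gives the blocks the sparsity 1/1024; `c₂` is c/4, because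
  -- strong pairs arise from quarters of blocks.
  let K , 1≤cK = archimedean c 0<c
      λ₀ , 0<λ₀ , λ₀L≡1 = reciprocal (1024 * (suc K * suc K))
  in λ₀ , c ℚ.* (ℤ.+ 1 ℚ./ 4) , 0<λ₀ , c₂-pos , λ n G λ' _ _ λ'≤λ₀ χ →
     case copy G (U χ) (blocks χ {suc K} 1≤cK {c ℚ.* (ℤ.+ 1 ℚ./ 4)} (quarter-≤ {c}) {λ₀} λ₀L≡1 λ'≤λ₀) of λ where
       (inj₁ strong) → inj₂ strong
       (inj₂ found)  → let t , embedded = embedding χ found in inj₁ (t , embedded)
  where
  c₂-pos : 0ℚ ℚ.< c ℚ.* (ℤ.+ 1 ℚ./ 4)
  c₂-pos = ℚ.positive⁻¹ _ {{ℚ.pos*pos⇒pos c {{ℚ.positive 0<c}} (ℤ.+ 1 ℚ./ 4)}}
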